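{- Let $G_1$ be the graph with vertex set $\{u_1,u_2,u_3,u_4,v_1,v_2,v_3,v_4,v_5,v_6,v_7\}$ whose edges are the four edges of the cycle $u_1u_2u_3u_4u_1$, the seven edges of the cycle $v_1v_2v_3v_4v_5v_6v_7v_1$, and the five edges $u_1v_1$, $u_2v_3$, $u_3v_4$, $u_4v_6$, $v_2v_5$. Then $G_1$ is subcubic, planar, and has girth $4$, and $G_1$ has no $(1,2^5)$-packing edge-coloring.
   Context: A graph is subcubic if its maximum degree is at most $3$. The girth of a graph is the length of a shortest cycle. For distinct edges $e,f$ of $G$, the distance between $e$ and $f$ is the distance between the corresponding vertices of the line graph $L(G)$ (so edges sharing an endpoint are at distance $1$). A $(1,2^5)$-packing edge-coloring of $G$ is a partition of $E(G)$ into six classes (possibly empty) such that in the first class any two distinct edges are at distance at least $2$ (the class is a matching), and in each of the remaining five classes any two distinct edges are at distance at least $3$ (the class is an induced matching). -}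

module Defs where

open import Data.Fin as Fin using (Fin; suc)
open import Data.Fin.Patterns
import Data.Fin.Properties as Fin
open import Data.List using (List; []; _∷_; _∷ʳ_; length; map; filter; allFin)
open import Data.List.Extrema.Nat using (max)
import Data.List.Membership.DecPropositional as DecMembership
open import Data.List.Membership.Propositional using (_∈_)
open import Data.List.Relation.Unary.All as All using (All)
open import Data.List.Relation.Unary.Linked using (Linked)
open import Data.List.Relation.Unary.Unique.Propositional using (Unique)
open import Data.Nat as ℕ using (ℕ; suc)
open import Data.Product using (_×_; _,_; ∃; ∃-syntax)
import Data.Product.Properties as Product
open import Data.Rational using (ℚ; 0ℚ; 1ℚ; _+_; _-_; ∣_∣; _≤_; _<_; _≤?_)
open import Data.Rational.Properties using (+-inverseʳ; +-identityʳ; +-monoʳ-≤; <⇒≤; ≤-trans)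
open import Data.Sum using (_⊎_; inj₁; inj₂; swap)
open import Data.Vec using (Vec; lookup)
open import Relation.Binary using (Rel; Symmetric; Irreflexive; Decidable; DecidableEquality)
open import Relation.Binary.PropositionalEquality using (_≡_; _≢_; refl; sym; subst)
open import Relation.Nullary using (¬_; yes; no; ¬?)
open import Relation.Nullary.Decidable using (_×-dec_; _⊎-dec_; from-yes)
open import Level using (0ℓ)

------------------------------------------------------------------------
-- Graphs

record Graph (V : Set) : Set₁ where
  field
    _~_      : Rel V 0ℓ
    ~-sym    : Symmetric _~_
    ~-irrefl : Irreflexive _≡_ _~_
    _~?_     : Decidable _~_

degree : ∀ {n} → Graph (Fin n) → Fin n → ℕ
degree {n} G v = length (filter (v ~?_) (allFin n))
  where open Graph G

maxDegree : ∀ {n} → Graph (Fin n) → ℕ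
maxDegree {n} G = max 0 (map (degree G) (allFin n))

Subcubic : ∀ {n} → Graph (Fin n) → Set
Subcubic G = maxDegree G ℕ.≤ 3

-- A cycle is listed by its vertices x, x₁, …, xₖ, without repeating the
-- starting vertex; its length is the number of vertices listed.
record Cycle {V : Set} (G : Graph V) : Set where
  open Graph G
  field
    start    : V
    others   : List V
    3≤length : 3 ℕ.≤ length (start ∷ others)
    distinct : Unique (start ∷ others)
    closed   : Linked _~_ (start ∷ others ∷ʳ start)

cycleLength : ∀ {V} {G : Graph V} → Cycle G → ℕ
cycleLength C = length (Cycle.start C ∷ Cycle.others C)

HasGirth : ∀ {V} → Graph V → ℕ → Set
HasGirth G g = (∃ λ (C : Cycle G) → cycleLength C ≡ g)
             × (∀ (C : Cycle G) → g ℕ.≤ cycleLength C)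

data Walk {V : Set} (G : Graph V) : ℕ → V → V → Set where
  []  : ∀ {u} → Walk G 0 u u
  _∷_ : ∀ {k u v w} → Graph._~_ G u v → Walk G k v w → Walk G (suc k) u w

-- The distance is the least length of a walk, and infinite when there is
-- no walk; vertices in different components satisfy every lower bound.
DistanceAtLeast : ∀ {V} → Graph V → ℕ → V → V → Set
DistanceAtLeast G d u v = ∀ k → Walk G k u v → d ℕ.≤ k

------------------------------------------------------------------------
-- Edges and the line graph

-- Every unordered pair of adjacent vertices is recorded once, smaller
-- vertex first.  The irrelevant fields make _≡_ on edges agree with
-- equality of the sets of endpoints.
record Edge {n} (G : Graph (Fin n)) : Set where
  constructor edge
  open Graph G
  field
    src tgt   : Fin n
    .src<tgt  : src Fin.< tgt
    .adjacent : src ~ tgt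

module _ {n : ℕ} {G : Graph (Fin n)} where
  open Edge

  _≟ᵉ_ : DecidableEquality (Edge G)
  edge a b _ _ ≟ᵉ edge c d _ _ with a Fin.≟ c | b Fin.≟ d
  ... | yes refl | yes refl = yes refl
  ... | no a≢c   | _        = no λ { refl → a≢c refl }
  ... | yes _    | no b≢d   = no λ { refl → b≢d refl }

  _isEndOf_ : Fin n → Edge G → Set
  v isEndOf e = v ≡ src e ⊎ v ≡ tgt e

  _isEndOf?_ : Decidable _isEndOf_
  v isEndOf? e = (v Fin.≟ src e) ⊎-dec (v Fin.≟ tgt e)

  ShareEnd : Rel (Edge G) 0ℓ
  ShareEnd e f = ∃[ v ] (v isEndOf e × v isEndOf f)

lineGraph : ∀ {n} (G : Graph (Fin n)) → Graph (Edge G)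
lineGraph G = record
  { _~_      = λ e f → e ≢ f × ShareEnd e f
  ; ~-sym    = λ (e≢f , v , p , q) → (λ f≡e → e≢f (sym f≡e)) , v , q , p
  ; ~-irrefl = λ e≡f (e≢f , _) → e≢f e≡f
  ; _~?_     = λ e f → ¬? (e ≟ᵉ f) ×-dec
                       Fin.any? (λ v → (v isEndOf? e) ×-dec (v isEndOf? f))
  }

-- For s = (s₁, …, sₖ): a partition of E(G) into k possibly empty classes
-- such that distinct edges of the i-th class are at distance at least
-- sᵢ + 1.
record PackingEdgeColoring {n k} (G : Graph (Fin n)) (s : Vec ℕ k) : Set where
  field
    colour  : Edge G → Fin k
    packing : ∀ e f → e ≢ f → colour e ≡ colour f →
              DistanceAtLeast (lineGraph G) (suc (lookup s (colour e))) e f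

------------------------------------------------------------------------
-- Real numbers, as Cauchy sequences of rationals

record ℝ : Set where
  field
    seq    : ℕ → ℚ
    cauchy : ∀ ε → 0ℚ < ε → ∃[ N ] ∀ m n → N ℕ.≤ m → N ℕ.≤ n →
             ∣ seq m - seq n ∣ < ε
open ℝ

fromℚ : ℚ → ℝ
fromℚ q = record
  { seq    = λ _ → q
  ; cauchy = λ ε 0<ε → 0 , λ _ _ _ _ →
      subst (λ r → ∣ r ∣ < ε) (sym (+-inverseʳ q)) 0<ε
  }

infix 4 _≤ʳ_ _<ʳ_ _≃ʳ_ _≃²_

_<ʳ_ : Rel ℝ 0ℓ
x <ʳ y = ∃[ ε ] (0ℚ < ε × ∃[ N ] ∀ n → N ℕ.≤ n → seq x n + ε ≤ seq y n)

_≤ʳ_ : Rel ℝ 0ℓ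
x ≤ʳ y = ∀ ε → 0ℚ < ε → ∃[ N ] ∀ n → N ℕ.≤ n → seq x n ≤ seq y n + ε

-- ∣ x - y ∣ < ε.  The slack δ is needed because a strict inequality
-- between the terms of two sequences only gives ≤ between the limits.
Near : ℚ → Rel ℝ 0ℓ
Near ε x y = ∃[ δ ] (0ℚ < δ × ∃[ N ] ∀ n → N ℕ.≤ n →
                     ∣ seq x n - seq y n ∣ + δ ≤ ε)

_≃ʳ_ : Rel ℝ 0ℓ
x ≃ʳ y = ∀ ε → 0ℚ < ε → Near ε x y

record UnitInterval : Set where
  field
    value : ℝ
    0≤    : fromℚ 0ℚ ≤ʳ value
    ≤1    : value ≤ʳ fromℚ 1ℚ
open UnitInterval

private
  ≤+ε : ∀ p {ε} → 0ℚ < ε → p ≤ p + ε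
  ≤+ε p {ε} 0<ε = subst (_≤ p + ε) (+-identityʳ p)
                        (+-monoʳ-≤ p (<⇒≤ 0<ε))

≤ʳ-const : ∀ {p q} → p ≤ q → fromℚ p ≤ʳ fromℚ q
≤ʳ-const {q = q} p≤q ε 0<ε = 0 , λ _ _ → ≤-trans p≤q (≤+ε q 0<ε)

0ᴵ 1ᴵ : UnitInterval
0ᴵ = record { value = fromℚ 0ℚ ; 0≤ = ≤ʳ-const (from-yes (0ℚ ≤? 0ℚ))
                               ; ≤1 = ≤ʳ-const (from-yes (0ℚ ≤? 1ℚ)) }
1ᴵ = record { value = fromℚ 1ℚ ; 0≤ = ≤ʳ-const (from-yes (0ℚ ≤? 1ℚ))
                               ; ≤1 = ≤ʳ-const (from-yes (1ℚ ≤? 1ℚ)) }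

Interior : UnitInterval → Set
Interior t = fromℚ 0ℚ <ʳ value t × value t <ʳ fromℚ 1ℚ

------------------------------------------------------------------------
-- The plane and planar graphs

ℝ² : Set
ℝ² = ℝ × ℝ

-- Distance less than ε in the maximum norm, which induces the usual
-- topology of the plane.
Near² : ℚ → Rel ℝ² 0ℓ
Near² ε (x , y) (x′ , y′) = Near ε x x′ × Near ε y y′

_≃²_ : Rel ℝ² 0ℓ
(x , y) ≃² (x′ , y′) = x ≃ʳ x′ × y ≃ʳ y′

-- ε and δ range over the positive rationals.  Since points at distance
-- less than every δ are sent to points at distance less than every ε, a
-- continuous function respects equality of reals.
Continuous : (UnitInterval → ℝ²) → Set
Continuous γ = ∀ t ε → 0ℚ < ε → ∃[ δ ] (0ℚ < δ ×
  ∀ s → Near δ (value t) (value s) → Near² ε (γ t) (γ s))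

record Arc (P Q : ℝ²) : Set where
  field
    path       : UnitInterval → ℝ²
    continuous : Continuous path
    injective  : ∀ s t → path s ≃² path t → value s ≃ʳ value t
    path-0     : path 0ᴵ ≃² P
    path-1     : path 1ᴵ ≃² Q

record PlaneDrawing {n} (G : Graph (Fin n)) : Set where
  open Edge
  open Arc
  field
    point           : Fin n → ℝ²
    point-injective : ∀ u v → point u ≃² point v → u ≡ v
    arc             : (e : Edge G) → Arc (point (src e)) (point (tgt e))
    avoids-vertices : ∀ e t → Interior t → ∀ v → ¬ path (arc e) t ≃² point v
    no-crossing     : ∀ e f → e ≢ f → ∀ s t → Interior s →
                      ¬ path (arc e) s ≃² path (arc f) t

Planar : ∀ {n} → Graph (Fin n) → Set
Planar = PlaneDrawing

------------------------------------------------------------------------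
-- The graph G₁

module _ {n : ℕ} where
  open DecMembership (Product.≡-dec (Fin._≟_ {n}) (Fin._≟_ {n})) using (_∈?_)

  fromEdges : (es : List (Fin n × Fin n)) → All (λ (u , v) → u ≢ v) es →
              Graph (Fin n)
  fromEdges es noLoop = record
    { _~_      = λ u v → (u , v) ∈ es ⊎ (v , u) ∈ es
    ; ~-sym    = swap
    ; ~-irrefl = λ { refl (inj₁ p) → All.lookup noLoop p refl
                   ; refl (inj₂ p) → All.lookup noLoop p refl }
    ; _~?_     = λ u v → ((u , v) ∈? es) ⊎-dec ((v , u) ∈? es)
    }

pattern u₁ = 0F
pattern u₂ = 1F
pattern u₃ = 2F
pattern u₄ = 3F
pattern v₁ = 4F
pattern v₂ = 5F
pattern v₃ = 6F
pattern v₄ = 7F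
pattern v₅ = 8F
pattern v₆ = 9F
pattern v₇ = suc 9F

G₁-edges : List (Fin 11 × Fin 11)
G₁-edges =
  (u₁ , u₂) ∷ (u₂ , u₃) ∷ (u₃ , u₄) ∷ (u₄ , u₁) ∷
  (v₁ , v₂) ∷ (v₂ , v₃) ∷ (v₃ , v₄) ∷ (v₄ , v₅) ∷ (v₅ , v₆) ∷ (v₆ , v₇) ∷ (v₇ , v₁) ∷
  (u₁ , v₁) ∷ (u₂ , v₃) ∷ (u₃ , v₄) ∷ (u₄ , v₆) ∷ (v₂ , v₅) ∷ []

G₁ : Graph (Fin 11)
G₁ = fromEdges G₁-edges
  (from-yes (All.all? (λ (u , v) → ¬? (u Fin.≟ v)) G₁-edges))

{-# OPTIONS --safe #-}

-- A matching of a graph with 11 vertices has at most 5 edges, and of any three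
-- edges of G₁ two are at distance at most 2, so an induced matching has at
-- most 2 edges.  Hence the six classes of a packing colouring cover at most
-- 5 + 5 · 2 = 15 of the 16 edges.
--
-- G₁ has a straight-line drawing with integer coordinates.  Two edges do not
-- cross when some line has them on different sides, one edge not being
-- contained in the line; an edge of positive length then has its interior
-- strictly on one side.

module Submission where

open import Defs
open import Data.Product using (_×_)
open import Data.Vec using (_∷_; replicate)
open import Relation.Nullary using (¬_)

open import Data.Fin as Fin using (Fin; zero; suc; toℕ)
import Data.Fin.Properties as Fin
import Data.Integer as ℤ
open import Data.List as List using (List; []; _∷_; length; filter; map; concatMap)
open import Data.List.Properties using (filter-accept; filter-reject)
open import Data.List.Membership.Propositional using (_∈_)
open import Data.List.Membership.Propositional.Properties using (∈-lookup; ∈-map⁻; ∈-filter⁺)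
import Data.List.Membership.DecPropositional as DecMembership
open import Data.List.Relation.Unary.All as All using (All; []; _∷_)
import Data.List.Relation.Unary.All.Properties as All
open import Data.List.Relation.Unary.AllPairs as AllPairs using (AllPairs; []; _∷_)
import Data.List.Relation.Unary.AllPairs.Properties as AllPairs
open import Data.List.Relation.Unary.Any as Any using (Any; here; there)
open import Data.List.Relation.Unary.Linked using (_∷_; linked?)
open import Data.List.Relation.Unary.Unique.Propositional using (Unique)
import Data.List.Relation.Unary.Unique.Propositional.Properties as Unique
open import Data.Nat as ℕ using (ℕ; zero; suc; z≤n; s≤s)
import Data.Nat.Properties as ℕ
open import Data.Product using (_,_; proj₁; proj₂; ∃-syntax)
import Data.Product.Properties as Product
open import Data.Rational
open import Data.Rational.Properties
open import Data.Rational.Solver using (module +-*-Solver)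
open import Data.Sum using (_⊎_; inj₁; inj₂)
open import Data.Vec as Vec using (Vec; []; sum; _[_]%=_)
open import Data.Vec.Properties using (lookup∘updateAt; lookup∘updateAt′; lookup-replicate)
open import Function using (_∘_; Injective)
open import Relation.Binary using (Decidable)
open import Relation.Binary.PropositionalEquality
  using (_≡_; _≢_; refl; sym; trans; cong; subst; subst₂)
open import Relation.Nullary using (Dec; yes; no; ¬?; contradiction; recompute)
open import Relation.Nullary.Decidable using (_×-dec_; _⊎-dec_; _→-dec_; from-yes; True; toWitness)

open ℝ
open UnitInterval
open Edge
open +-*-Solver using (solve; _:=_; _:+_; _:-_; _:*_; con)

-- Pigeonhole principles

module _ {A : Set} where

  lookup-injective : ∀ {xs : List A} → Unique xs → Injective _≡_ _≡_ (List.lookup xs)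
  lookup-injective (_  ∷ _) {zero}  {zero}  _  = refl
  lookup-injective (x∉ ∷ _) {zero}  {suc j} eq = contradiction eq (All.lookup x∉ (∈-lookup j))
  lookup-injective (x∉ ∷ _) {suc i} {zero}  eq = contradiction (sym eq) (All.lookup x∉ (∈-lookup i))
  lookup-injective (_  ∷ u) {suc i} {suc j} eq = cong suc (lookup-injective u eq)

  module _ {k} (f : A → Fin k) where

    fibre : Fin k → List A → List A
    fibre c = filter (λ x → f x Fin.≟ c)

    -- By induction on the list: dropping the head `x` lowers the bound of its class by one. That
    -- bound is positive because the class contains `x`, so the truncated `ℕ.pred` really subtracts.
    length≤sum-fibres : ∀ (bounds : Vec ℕ k) xs →
                        (∀ c → length (fibre c xs) ℕ.≤ Vec.lookup bounds c) →
                        length xs ℕ.≤ sum bounds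
    length≤sum-fibres bounds []       _     = z≤n
    length≤sum-fibres bounds (x ∷ xs) bound =
      subst (suc (length xs) ℕ.≤_) (suc-sum-pred (f x) bounds (ℕ.≤-trans (s≤s z≤n) fibre-x))
        (s≤s (length≤sum-fibres (bounds [ f x ]%= ℕ.pred) xs bound′))
      where
      fibre-x : suc (length (fibre (f x) xs)) ℕ.≤ Vec.lookup bounds (f x)
      fibre-x = subst (λ l → length l ℕ.≤ Vec.lookup bounds (f x)) (filter-accept (λ y → f y Fin.≟ f x) refl) (bound (f x))

      bound′ : ∀ c → length (fibre c xs) ℕ.≤ Vec.lookup (bounds [ f x ]%= ℕ.pred) c
      bound′ c with f x Fin.≟ c
      ... | yes refl rewrite lookup∘updateAt (f x) {f = ℕ.pred} bounds = ℕ.pred-mono-≤ fibre-x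
      ... | no fx≢c  rewrite lookup∘updateAt′ c (f x) {f = ℕ.pred} (fx≢c ∘ sym) bounds =
        subst (λ l → length l ℕ.≤ Vec.lookup bounds c) (filter-reject (λ y → f y Fin.≟ c) fx≢c) (bound c)

      suc-sum-pred : ∀ {k} (i : Fin k) (ns : Vec ℕ k) → 1 ℕ.≤ Vec.lookup ns i →
                     suc (sum (ns [ i ]%= ℕ.pred)) ≡ sum ns
      suc-sum-pred zero    (suc n ∷ ns) _   = refl
      suc-sum-pred (suc i) (n ∷ ns)     1≤n =
        trans (sym (ℕ.+-suc n _)) (cong (n ℕ.+_) (suc-sum-pred i ns 1≤n))

length-unique : ∀ {n} {xs : List (Fin n)} → Unique xs → length xs ℕ.≤ n
length-unique unique = Fin.injective⇒≤ (lookup-injective unique)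

-- Packing edge-colourings

module _ {n} {G : Graph (Fin n)} where
  open Graph (lineGraph G)

  ends : Edge G → List (Fin n)
  ends e = src e ∷ tgt e ∷ []

  ∈-ends : ∀ {v} e → v ∈ ends e → v isEndOf e
  ∈-ends e (here v≡)         = inj₁ v≡
  ∈-ends e (there (here v≡)) = inj₂ v≡

  ends-unique : ∀ e → Unique (ends e)
  ends-unique (edge a b a<b _) =
    ((λ a≡b → Fin.<⇒≢ (recompute (a Fin.<? b) a<b) a≡b) ∷ []) ∷ [] ∷ []

  length-allEnds : ∀ es → length (concatMap ends es) ≡ 2 ℕ.* length es
  length-allEnds []       = refl
  length-allEnds (e ∷ es) = trans (cong (2 ℕ.+_) (length-allEnds es)) (sym (ℕ.*-suc 2 (length es)))

  -- The shift `suc s` follows `PackingEdgeColoring`: pairwise `Apart 1` is a matching, pairwise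
  -- `Apart 2` an induced matching.
  Apart : ℕ → Edge G → Edge G → Set
  Apart s e f = e ≢ f × DistanceAtLeast (lineGraph G) (suc s) e f

  -- Distinct edges with a common end are joined by a walk of length 1 in the line graph, so the
  -- ends of all listed edges are distinct vertices.
  matching-bound : ∀ {es} → AllPairs (Apart 1) es → 2 ℕ.* length es ℕ.≤ n
  matching-bound {es} apart = subst (ℕ._≤ n) (length-allEnds es)
    (length-unique (Unique.concat⁺ (All.map⁺ (All.universal ends-unique es))
                                   (AllPairs.map⁺ (AllPairs.map disjoint apart))))
    where
    disjoint : ∀ {e f} → Apart 1 e f → ∀ {v} → ¬ (v ∈ ends e × v ∈ ends f)
    disjoint {e} {f} (e≢f , dist) {v} (v∈e , v∈f)
      with dist 1 ((e≢f , v , ∈-ends e v∈e , ∈-ends f v∈f) ∷ [])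
    ... | s≤s ()

  class-apart : ∀ {k} {s : Vec ℕ k} (C : PackingEdgeColoring G s) c {es} → Unique es →
                AllPairs (Apart (Vec.lookup s c)) (fibre (PackingEdgeColoring.colour C) c es)
  class-apart {s = s} C c {es} unique =
    go (Unique.filter⁺ (λ e → colour e Fin.≟ c) unique)
       (All.all-filter (λ e → colour e Fin.≟ c) es)
    where
    open PackingEdgeColoring C
    go : ∀ {xs} → Unique xs → All (λ e → colour e ≡ c) xs → AllPairs (Apart (Vec.lookup s c)) xs
    go []          []            = []
    go (e∉ ∷ uniq) (refl ∷ cols) =
      All.zipWith (λ (e≢f , f≡c) → e≢f , packing _ _ e≢f (sym f≡c)) (e∉ , cols) ∷ go uniq cols

  -- A certificate for distance at most 2 in the line graph. The middle edge is taken from `hs`,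
  -- which makes the relation decidable by finite search.
  CloseVia : List (Edge G) → Edge G → Edge G → Set
  CloseVia hs e f = e ≡ f ⊎ e ~ f ⊎ Any (λ h → e ~ h × h ~ f) hs

  closeVia? : ∀ hs → Decidable (CloseVia hs)
  closeVia? hs e f = (e ≟ᵉ f) ⊎-dec (e ~? f) ⊎-dec Any.any? (λ h → (e ~? h) ×-dec (h ~? f)) hs

  close⇒¬apart : ∀ {hs e f} → CloseVia hs e f → ¬ Apart 2 e f
  close⇒¬apart (inj₁ e≡f) (e≢f , _) = e≢f e≡f
  close⇒¬apart (inj₂ (inj₁ e~f)) (_ , dist) with dist 1 (e~f ∷ [])
  ... | s≤s ()
  close⇒¬apart (inj₂ (inj₂ via)) (_ , dist)
    with _ , e~h , h~f ← Any.satisfied via with dist 2 (e~h ∷ h~f ∷ [])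
  ... | s≤s (s≤s ())

-- Rational arithmetic

divide : ∀ {K ε} → 0ℚ < K → 0ℚ < ε → ∃[ δ ] (0ℚ < δ × K * δ ≡ ε)
divide {K} {ε} 0<K 0<ε = 1/K * ε , positive⁻¹ _ {{pos*pos⇒pos 1/K ε}} , (begin-equality
  K * (1/K * ε)  ≡⟨ *-assoc K 1/K ε ⟨
  K * 1/K * ε    ≡⟨ cong (_* ε) (*-inverseʳ K) ⟩
  1ℚ * ε         ≡⟨ *-identityˡ ε ⟩
  ε              ∎)
  where
  open ≤-Reasoning
  instance
    K-pos : Positive K
    K-pos = positive 0<K
    K-nonZero : NonZero K
    K-nonZero = pos⇒nonZero K
    ε-pos : Positive ε
    ε-pos = positive 0<ε
  1/K = 1/ K
  instance
    1/K-pos : Positive 1/K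
    1/K-pos = 1/pos⇒pos K

minimum : ∀ {p q} → 0ℚ < p → 0ℚ < q → ∃[ m ] (0ℚ < m × m ≤ p × m ≤ q)
minimum {p} {q} 0<p 0<q with ≤-total p q
... | inj₁ p≤q = p , 0<p , ≤-refl , p≤q
... | inj₂ q≤p = q , 0<q , q≤p , ≤-refl

*-monoˡ-≤ : ∀ {p q r} → 0ℚ ≤ r → p ≤ q → r * p ≤ r * q
*-monoˡ-≤ {r = r} 0≤r = *-monoˡ-≤-nonNeg r {{nonNegative 0≤r}}

*-monoʳ-≤ : ∀ {p q r} → 0ℚ ≤ r → p ≤ q → p * r ≤ q * r
*-monoʳ-≤ {r = r} 0≤r = *-monoʳ-≤-nonNeg r {{nonNegative 0≤r}}

*-nonNeg : ∀ {p q} → 0ℚ ≤ p → 0ℚ ≤ q → 0ℚ ≤ p * q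
*-nonNeg {p} {q} 0≤p 0≤q = subst (_≤ p * q) (*-zeroʳ p) (*-monoˡ-≤ 0≤p 0≤q)

p≤∣p∣ : ∀ p → p ≤ ∣ p ∣
p≤∣p∣ p with ≤-total 0ℚ p
... | inj₁ 0≤p = ≤-reflexive (sym (0≤p⇒∣p∣≡p 0≤p))
... | inj₂ p≤0 = ≤-trans p≤0 (0≤∣p∣ p)

p<p+δ : ∀ {p δ} → 0ℚ < δ → p < p + δ
p<p+δ {p} {δ} 0<δ = subst (_< p + δ) (+-identityʳ p) (+-monoʳ-< p 0<δ)

p<p+1 : ∀ p → p < p + 1ℚ
p<p+1 p = p<p+δ (positive⁻¹ 1ℚ)

p≤q⇒0≤q-p : ∀ {p q} → p ≤ q → 0ℚ ≤ q - p
p≤q⇒0≤q-p {p} {q} p≤q = subst (_≤ q - p) (+-inverseʳ p) (+-monoˡ-≤ (- p) p≤q)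

p+δ≤ε⇒p≤ε : ∀ {p δ ε} → 0ℚ < δ → p + δ ≤ ε → p ≤ ε
p+δ≤ε⇒p≤ε 0<δ p+δ≤ε = ≤-trans (<⇒≤ (p<p+δ 0<δ)) p+δ≤ε

∣affine∣ : ∀ p d x y → ∣ (p + d * x) - (p + d * y) ∣ ≡ ∣ d ∣ * ∣ x - y ∣
∣affine∣ p d x y = trans
  (cong ∣_∣ (solve 4 (λ p d x y → (p :+ d :* x) :- (p :+ d :* y) := d :* (x :- y)) refl p d x y))
  (∣p*q∣≡∣p∣*∣q∣ d (x - y))

-- Affine images of real numbers

affine : ℚ → ℚ → ℝ → ℝ
affine p d x = record
  { seq    = λ n → p + d * seq x n
  ; cauchy = λ ε 0<ε →
      let (δ , 0<δ , Kδ≡ε) = divide 0<K 0<ε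
          (N , close) = cauchy x δ 0<δ
      in N , λ m n N≤m N≤n → begin-strict
        ∣ (p + d * seq x m) - (p + d * seq x n) ∣  ≡⟨ ∣affine∣ p d (seq x m) (seq x n) ⟩
        ∣ d ∣ * ∣ seq x m - seq x n ∣              ≤⟨ *-monoʳ-≤ (0≤∣p∣ _) (<⇒≤ (p<p+1 ∣ d ∣)) ⟩
        K * ∣ seq x m - seq x n ∣                  <⟨ *-monoʳ-<-pos K {{positive 0<K}} (close m n N≤m N≤n) ⟩
        K * δ                                      ≡⟨ Kδ≡ε ⟩
        ε                                          ∎
  }
  where
  open ≤-Reasoning
  -- The summand 1 keeps the Lipschitz constant positive when `d` is 0.
  K = ∣ d ∣ + 1ℚ
  0<K : 0ℚ < K
  0<K = ≤-<-trans (0≤∣p∣ d) (p<p+1 ∣ d ∣)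

-- The map is `K`-Lipschitz; scaling the slack `γ` by `K` as well lets `K` be factored out.
Near-affine : ∀ p {d K δ ε x y} → 0ℚ < K → ∣ d ∣ ≤ K → K * δ ≡ ε → Near δ x y →
              Near ε (affine p d x) (affine p d y)
Near-affine p {d} {K} {δ} {ε} {x} {y} 0<K ∣d∣≤K Kδ≡ε (γ , 0<γ , N , near) =
  K * γ , positive⁻¹ _ {{pos*pos⇒pos K {{positive 0<K}} γ {{positive 0<γ}}}} , N , λ n N≤n → begin
    ∣ (p + d * seq x n) - (p + d * seq y n) ∣ + K * γ  ≡⟨ cong (_+ K * γ) (∣affine∣ p d (seq x n) (seq y n)) ⟩
    ∣ d ∣ * ∣ seq x n - seq y n ∣ + K * γ              ≤⟨ +-monoˡ-≤ (K * γ) (*-monoʳ-≤ (0≤∣p∣ _) ∣d∣≤K) ⟩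
    K * ∣ seq x n - seq y n ∣ + K * γ                  ≡⟨ *-distribˡ-+ K _ γ ⟨
    K * (∣ seq x n - seq y n ∣ + γ)                    ≤⟨ *-monoˡ-≤ (<⇒≤ 0<K) (near n N≤n) ⟩
    K * δ                                              ≡⟨ Kδ≡ε ⟩
    ε                                                  ∎
  where open ≤-Reasoning

-- A slope of absolute value at least 1 shrinks no distance, so the slack and the index carry over
-- unchanged.
affine-injective : ∀ p {d x y} → 1ℚ ≤ ∣ d ∣ → affine p d x ≃ʳ affine p d y → x ≃ʳ y
affine-injective p {d} {x} {y} 1≤∣d∣ eq ε 0<ε with γ , 0<γ , N , near ← eq ε 0<ε =
  γ , 0<γ , N , λ n N≤n → begin
    ∣ seq x n - seq y n ∣ + γ                      ≡⟨ cong (_+ γ) (*-identityˡ ∣ seq x n - seq y n ∣) ⟨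
    1ℚ * ∣ seq x n - seq y n ∣ + γ                 ≤⟨ +-monoˡ-≤ γ (*-monoʳ-≤ (0≤∣p∣ _) 1≤∣d∣) ⟩
    ∣ d ∣ * ∣ seq x n - seq y n ∣ + γ              ≡⟨ cong (_+ γ) (∣affine∣ p d (seq x n) (seq y n)) ⟨
    ∣ (p + d * seq x n) - (p + d * seq y n) ∣ + γ  ≤⟨ near n N≤n ⟩
    ε                                              ∎
  where open ≤-Reasoning

pointwise⇒≃ʳ : ∀ x y → (∀ n → seq x n ≡ seq y n) → x ≃ʳ y
pointwise⇒≃ʳ x y eq ε 0<ε = ε , 0<ε , 0 , λ n _ → ≤-reflexive
  (trans (cong (λ q → ∣ q - seq y n ∣ + ε) (eq n))
         (trans (cong (λ q → ∣ q ∣ + ε) (+-inverseʳ (seq y n))) (+-identityˡ ε)))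

≃ʳ-respʳ : ∀ {x y z} → (∀ n → seq y n ≡ seq z n) → x ≃ʳ y → x ≃ʳ z
≃ʳ-respʳ {x} eq x≃y ε 0<ε with γ , 0<γ , N , near ← x≃y ε 0<ε =
  γ , 0<γ , N , λ n N≤n → subst (λ q → ∣ seq x n - q ∣ + γ ≤ ε) (eq n) (near n N≤n)

p+d0≡p : ∀ p d → p + d * 0ℚ ≡ p
p+d0≡p p d = trans (cong (p +_) (*-zeroʳ d)) (+-identityʳ p)

affine-0 : ∀ p d → affine p d (fromℚ 0ℚ) ≃ʳ fromℚ p
affine-0 p d = pointwise⇒≃ʳ (affine p d (fromℚ 0ℚ)) (fromℚ p) (λ _ → p+d0≡p p d)

affine-1 : ∀ p q → affine p (q - p) (fromℚ 1ℚ) ≃ʳ fromℚ q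
affine-1 p q = pointwise⇒≃ʳ (affine p (q - p) (fromℚ 1ℚ)) (fromℚ q)
  (λ _ → solve 2 (λ p q → p :+ (q :- p) :* con 1ℚ := q) refl p q)

-- Segments between rational points

ℚ² : Set
ℚ² = ℚ × ℚ

embed : ℚ² → ℝ²
embed (p , q) = fromℚ p , fromℚ q

segment : ℚ² → ℚ² → UnitInterval → ℝ²
segment (p₁ , p₂) (q₁ , q₂) t = affine p₁ (q₁ - p₁) (value t) , affine p₂ (q₂ - p₂) (value t)

-- The hypothesis makes the first coordinate alone injective along the segment.
segment-arc : ∀ P Q → 1ℚ ≤ ∣ proj₁ Q - proj₁ P ∣ → Arc (embed P) (embed Q)
segment-arc P@(p₁ , p₂) Q@(q₁ , q₂) 1≤∣d∣ = record
  { path       = segment P Q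
  ; continuous = λ t ε 0<ε →
      let (δ , 0<δ , Kδ≡ε) = divide 0<K 0<ε
      in δ , 0<δ , λ s near → Near-affine p₁ {x = value t} {value s} 0<K d₁≤K Kδ≡ε near
                            , Near-affine p₂ {x = value t} {value s} 0<K d₂≤K Kδ≡ε near
  ; injective  = λ s t (eq , _) → affine-injective p₁ {x = value s} {value t} 1≤∣d∣ eq
  ; path-0     = affine-0 p₁ (q₁ - p₁) , affine-0 p₂ (q₂ - p₂)
  ; path-1     = affine-1 p₁ q₁ , affine-1 p₂ q₂
  }
  where
  d₁ = ∣ q₁ - p₁ ∣
  d₂ = ∣ q₂ - p₂ ∣
  -- One Lipschitz constant for both coordinates, positive because `d₁` is at least 1.
  K = d₁ + d₂
  d₁≤K : d₁ ≤ K
  d₁≤K = subst (_≤ K) (+-identityʳ d₁) (+-monoʳ-≤ d₁ (0≤∣p∣ (q₂ - p₂)))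
  d₂≤K : d₂ ≤ K
  d₂≤K = subst (_≤ K) (+-identityˡ d₂) (+-monoˡ-≤ d₂ (0≤∣p∣ (q₁ - p₁)))
  0<K : 0ℚ < K
  0<K = <-≤-trans (positive⁻¹ 1ℚ) (≤-trans 1≤∣d∣ d₁≤K)

-- Separation by a linear functional

infix 8 _·_
_·_ : ℚ² → ℚ² → ℚ
(a , b) · (x , y) = a * x + b * y

-- Given the first two inequalities, the third keeps `P` and `Q` from both lying on the line. One of
-- them may lie on it, as happens for edges with a common end.
Separates : ℚ² × ℚ → (P Q R S : ℚ²) → Set
Separates (ℓ , c) P Q R S = c ≤ ℓ · P × c ≤ ℓ · Q × c + c < ℓ · P + ℓ · Q × ℓ · R ≤ c × ℓ · S ≤ c

-- One point divides a segment in the ratio s : 1 - s, the other, up to ε, a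
-- segment in the ratio t : 1 - t.  The functional (a , b) places the ends of
-- the two segments at heights p, q above and r, w below the separating line,
-- and x, y are the differences of the coordinates of the points.
no-common-point : ∀ {a b p q r w s t m ε x y} →
  0ℚ ≤ p → 0ℚ ≤ q → 0ℚ ≤ r → 0ℚ ≤ w → 0ℚ < ε →
  m ≤ s → m ≤ 1ℚ - s → 0ℚ ≤ t + ε → 0ℚ ≤ (1ℚ + ε) - t → ∣ x ∣ ≤ ε → ∣ y ∣ ≤ ε →
  (∣ a ∣ + ∣ b ∣ + r + w + 1ℚ) * ε ≡ m * (p + q) →
  a * x + b * y ≢ (1ℚ - s) * p + s * q + ((1ℚ - t) * r + t * w)
no-common-point {a} {b} {p} {q} {r} {w} {s} {t} {m} {ε} {x} {y}
  0≤p 0≤q 0≤r 0≤w 0<ε m≤s m≤1-s 0≤t+ε 0≤1+ε-t ∣x∣≤ε ∣y∣≤ε Kε≡ eq = <-irrefl refl (begin-strict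
    m * (p + q)
      ≡⟨ solve 3 (λ m p q → m :* (p :+ q) := m :* p :+ m :* q :+ (con 0ℚ :+ con 0ℚ)) refl m p q ⟩
    m * p + m * q + (0ℚ + 0ℚ)
      -- The parameter `t` lies in the unit interval only up to `ε`. Adding `ε` makes its two
      -- weights nonnegative, at a cost of `(r + w) * ε`.
      ≤⟨ +-mono-≤ (+-mono-≤ (*-monoʳ-≤ 0≤p m≤1-s) (*-monoʳ-≤ 0≤q m≤s))
                  (+-mono-≤ (*-nonNeg 0≤1+ε-t 0≤r) (*-nonNeg 0≤t+ε 0≤w)) ⟩
    (1ℚ - s) * p + s * q + (((1ℚ + ε) - t) * r + (t + ε) * w)
      ≡⟨ solve 7 (λ p q r w s t ε →
           (con 1ℚ :- s) :* p :+ s :* q :+ (((con 1ℚ :+ ε) :- t) :* r :+ (t :+ ε) :* w) :=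
           (con 1ℚ :- s) :* p :+ s :* q :+ ((con 1ℚ :- t) :* r :+ t :* w) :+ (r :+ w) :* ε)
           refl p q r w s t ε ⟩
    (1ℚ - s) * p + s * q + ((1ℚ - t) * r + t * w) + (r + w) * ε
      ≡⟨ cong (_+ (r + w) * ε) eq ⟨
    a * x + b * y + (r + w) * ε
      ≤⟨ +-monoˡ-≤ ((r + w) * ε) (+-mono-≤ (bound a ∣x∣≤ε) (bound b ∣y∣≤ε)) ⟩
    ∣ a ∣ * ε + ∣ b ∣ * ε + (r + w) * ε
      -- The summand 1 in the constant makes the chain strict.
      <⟨ +-monoʳ-< (∣ a ∣ * ε + ∣ b ∣ * ε) (*-monoˡ-<-pos ε {{positive 0<ε}} (p<p+1 (r + w))) ⟩
    ∣ a ∣ * ε + ∣ b ∣ * ε + ((r + w) + 1ℚ) * ε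
      ≡⟨ solve 5 (λ a b r w ε → a :* ε :+ b :* ε :+ ((r :+ w) :+ con 1ℚ) :* ε :=
                               (a :+ b :+ r :+ w :+ con 1ℚ) :* ε) refl ∣ a ∣ ∣ b ∣ r w ε ⟩
    (∣ a ∣ + ∣ b ∣ + r + w + 1ℚ) * ε
      ≡⟨ Kε≡ ⟩
    m * (p + q) ∎)
  where
  open ≤-Reasoning
  bound : ∀ c {z} → ∣ z ∣ ≤ ε → c * z ≤ ∣ c ∣ * ε
  bound c {z} ∣z∣≤ε = begin
    c * z          ≤⟨ p≤∣p∣ (c * z) ⟩
    ∣ c * z ∣      ≡⟨ ∣p*q∣≡∣p∣*∣q∣ c z ⟩
    ∣ c ∣ * ∣ z ∣  ≤⟨ *-monoˡ-≤ (0≤∣p∣ c) ∣z∣≤ε ⟩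
    ∣ c ∣ * ε      ∎

Eventually : (ℕ → Set) → Set
Eventually P = ∃[ N ] ∀ n → N ℕ.≤ n → P n

infixr 4 _and_
_and_ : ∀ {P Q} → Eventually P → Eventually Q → Eventually (λ n → P n × Q n)
(M , p) and (N , q) = M ℕ.⊔ N , λ n M⊔N≤n →
  p n (ℕ.m⊔n≤o⇒m≤o M N M⊔N≤n) , q n (ℕ.m⊔n≤o⇒n≤o M N M⊔N≤n)

-- The parameter of an interior point stays at least `m` away from 0 and 1, so the point has height
-- at least `m * (p + q)`, a positive number, above the line. `ε` is chosen so that all errors
-- together stay below this, and a single index at which the six estimates hold gives the
-- contradiction.
separated⇒disjoint : ∀ {ℓc P Q R S} → Separates ℓc P Q R S → ∀ s t → Interior s →
                     ¬ segment P Q s ≃² segment R S t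
separated⇒disjoint {(a , b) , c} {P@(p₁ , p₂)} {Q@(q₁ , q₂)} {R@(r₁ , r₂)} {S@(s₁ , s₂)}
  (c≤P , c≤Q , 2c<P+Q , R≤c , S≤c) s t ((α , 0<α , α≤s) , (β , 0<β , s+β≤1)) (eq₁ , eq₂) =
  let
    (m , 0<m , m≤α , m≤β)     = minimum 0<α 0<β
    (ε , 0<ε , Kε≡)           = divide 0<K
      (positive⁻¹ _ {{pos*pos⇒pos m {{positive 0<m}} (p + q) {{positive 0<p+q}}}})
    (γ₁ , 0<γ₁ , near₁)       = eq₁ ε 0<ε
    (γ₂ , 0<γ₂ , near₂)       = eq₂ ε 0<ε
    (n , at)                  = α≤s and s+β≤1 and 0≤ t ε 0<ε and ≤1 t ε 0<ε and near₁ and near₂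
    (α≤sₙ , sₙ+β≤1 , 0≤tₙ+ε , tₙ≤1+ε , near₁ₙ , near₂ₙ) = at n ℕ.≤-refl
    sₙ = seq (value s) n
    tₙ = seq (value t) n
  in no-common-point {a} {b} {p} {q} {r} {w} {sₙ} {tₙ}
    (p≤q⇒0≤q-p c≤P) (p≤q⇒0≤q-p c≤Q) 0≤r 0≤w 0<ε
    (≤-trans m≤α (subst (_≤ sₙ) (+-identityˡ α) α≤sₙ))
    (≤-trans m≤β (subst (_≤ 1ℚ - sₙ) (cancel sₙ β) (+-monoˡ-≤ (- sₙ) sₙ+β≤1)))
    0≤tₙ+ε (p≤q⇒0≤q-p tₙ≤1+ε)
    (p+δ≤ε⇒p≤ε 0<γ₁ near₁ₙ) (p+δ≤ε⇒p≤ε 0<γ₂ near₂ₙ) Kε≡ (identity sₙ tₙ)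
  where
  ℓ = a , b
  p = ℓ · P - c
  q = ℓ · Q - c
  r = c - ℓ · R
  w = c - ℓ · S
  K = ∣ a ∣ + ∣ b ∣ + r + w + 1ℚ
  0≤r : 0ℚ ≤ r
  0≤r = p≤q⇒0≤q-p R≤c
  0≤w : 0ℚ ≤ w
  0≤w = p≤q⇒0≤q-p S≤c
  0<K : 0ℚ < K
  0<K = ≤-<-trans (+-mono-≤ (+-mono-≤ (+-mono-≤ (0≤∣p∣ a) (0≤∣p∣ b)) 0≤r) 0≤w) (p<p+1 _)
  0<p+q : 0ℚ < p + q
  0<p+q = subst₂ _<_ (+-inverseʳ (c + c))
    (solve 3 (λ P Q c → (P :+ Q) :- (c :+ c) := (P :- c) :+ (Q :- c)) refl (ℓ · P) (ℓ · Q) c)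
    (+-monoˡ-< (- (c + c)) 2c<P+Q)
  cancel : ∀ s β → (s + β) - s ≡ β
  cancel = solve 2 (λ s β → (s :+ β) :- s := β) refl
  -- Both sides are the value of the functional at the difference of the two points; `c` cancels
  -- because each pair of weights sums to 1.
  identity : ∀ s t → a * ((p₁ + (q₁ - p₁) * s) - (r₁ + (s₁ - r₁) * t))
                   + b * ((p₂ + (q₂ - p₂) * s) - (r₂ + (s₂ - r₂) * t))
                   ≡ (1ℚ - s) * p + s * q + ((1ℚ - t) * r + t * w)
  identity s t =
    solve 13 (λ a b c p₁ p₂ q₁ q₂ r₁ r₂ s₁ s₂ s t →
        a :* ((p₁ :+ (q₁ :- p₁) :* s) :- (r₁ :+ (s₁ :- r₁) :* t))
     :+ b :* ((p₂ :+ (q₂ :- p₂) :* s) :- (r₂ :+ (s₂ :- r₂) :* t)) :=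
        (con 1ℚ :- s) :* ((a :* p₁ :+ b :* p₂) :- c) :+ s :* ((a :* q₁ :+ b :* q₂) :- c)
     :+ ((con 1ℚ :- t) :* (c :- (a :* r₁ :+ b :* r₂)) :+ t :* (c :- (a :* s₁ :+ b :* s₂))))
      refl a b c p₁ p₂ q₁ q₂ r₁ r₂ s₁ s₂ s t

separates? : ∀ ℓc P Q R S → Dec (Separates ℓc P Q R S)
separates? (ℓ , c) P Q R S =
  (c ≤? ℓ · P) ×-dec (c ≤? ℓ · Q) ×-dec (c + c <? ℓ · P + ℓ · Q) ×-dec (ℓ · R ≤? c) ×-dec (ℓ · S ≤? c)

-- The direction vector after a clockwise quarter turn; exchanging the points gives the opposite
-- normal.
normal : ℚ² → ℚ² → ℚ²
normal (x , y) (x′ , y′) = y′ - y , x - x′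

-- If two segments can be separated at all, then by a line parallel to one of
-- them or, when they are collinear and not vertical, by a vertical line.
candidates : (P Q R S : ℚ²) → List (ℚ² × ℚ)
candidates P Q R S = map (λ ℓ → ℓ , ℓ · R ⊔ ℓ · S)
  (normal P Q ∷ normal Q P ∷ normal R S ∷ normal S R ∷ (1ℚ , 0ℚ) ∷ (- 1ℚ , 0ℚ) ∷ [])

-- A finite search stands in for all lines. For each functional tried, the greater of its values at
-- `R` and `S` is the least threshold with both below it, hence the best one.
Separable : (P Q R S : ℚ²) → Set
Separable P Q R S = Any (λ ℓc → Separates ℓc P Q R S) (candidates P Q R S)

separable? : ∀ P Q R S → Dec (Separable P Q R S)
separable? P Q R S = Any.any? (λ ℓc → separates? ℓc P Q R S) (candidates P Q R S)

separable⇒disjoint : ∀ {P Q R S} → Separable P Q R S → ∀ s t → Interior s →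
                     ¬ segment P Q s ≃² segment R S t
separable⇒disjoint {P} {Q} {R} {S} separable with ℓc , separates ← Any.satisfied separable =
  separated⇒disjoint {ℓc} {P} {Q} {R} {S} separates

-- Straight-line drawings

module _ {n} (position : Fin n → ℚ²) where

  Separated : (u v u′ v′ : Fin n) → Set
  Separated u v u′ v′ = Separable (position u) (position v) (position u′) (position v′)

  separated? : ∀ u v u′ v′ → Dec (Separated u v u′ v′)
  separated? u v u′ v′ = separable? (position u) (position v) (position u′) (position v′)

  -- The horizontal gaps give injectivity of the vertices and of the arcs. A vertex `v` counts as
  -- the degenerate segment from `v` to `v`, so one criterion serves vertices and edges.
  straightLineDrawing : ∀ {G : Graph (Fin n)} →
    (∀ u v → u ≢ v → 1ℚ ≤ ∣ proj₁ (position v) - proj₁ (position u) ∣) →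
    (∀ (e f : Edge G) → e ≡ f ⊎ Separated (src e) (tgt e) (src f) (tgt f)) →
    (∀ (e : Edge G) v → Separated (src e) (tgt e) v v) →
    PlaneDrawing G
  straightLineDrawing {G} x-apart edges-separated vertices-separated = record
    { point           = point
    ; point-injective = point-injective
    ; arc             = λ e → segment-arc (position (src e)) (position (tgt e)) (ends-apart e)
    ; avoids-vertices = λ e t interior v (eq₁ , eq₂) →
        let (p , q) = position v
            (x , y) = segment (position (src e)) (position (tgt e)) t
        in separable⇒disjoint (vertices-separated e v) t 0ᴵ interior
          ( ≃ʳ-respʳ {x} {fromℚ p} {affine p (p - p) (fromℚ 0ℚ)} (λ _ → sym (p+d0≡p p (p - p))) eq₁
          , ≃ʳ-respʳ {y} {fromℚ q} {affine q (q - q) (fromℚ 0ℚ)} (λ _ → sym (p+d0≡p q (q - q))) eq₂)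
    ; no-crossing     = no-crossing
    }
    where
    point : Fin n → ℝ²
    point v = embed (position v)

    point-injective : ∀ u v → point u ≃² point v → u ≡ v
    point-injective u v (eq , _) with u Fin.≟ v
    ... | yes u≡v = u≡v
    -- A distance below 1, with positive slack `γ`, contradicts the horizontal gap.
    ... | no u≢v with γ , 0<γ , N , near ← eq 1ℚ (positive⁻¹ 1ℚ) =
      contradiction (≤-<-trans (x-apart v u (λ v≡u → u≢v (sym v≡u)))
                               (<-≤-trans (p<p+δ 0<γ) (near N ℕ.≤-refl))) (<-irrefl refl)

    ends-apart : ∀ (e : Edge G) → 1ℚ ≤ ∣ proj₁ (position (tgt e)) - proj₁ (position (src e)) ∣
    ends-apart (edge u v u<v _) = x-apart u v (Fin.<⇒≢ (recompute (u Fin.<? v) u<v))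

    no-crossing : ∀ (e f : Edge G) → e ≢ f → ∀ s t → Interior s →
                  ¬ segment (position (src e)) (position (tgt e)) s ≃²
                    segment (position (src f)) (position (tgt f)) t
    no-crossing e f e≢f with edges-separated e f
    ... | inj₁ e≡f       = contradiction e≡f e≢f
    ... | inj₂ separable = separable⇒disjoint separable

-- The graph G₁

open Graph G₁ using (_~_; _~?_)

mkEdge : ∀ a b → {True (a Fin.<? b)} → {True (a ~? b)} → Edge G₁
mkEdge a b {a<b} {a~b} = edge a b (toWitness a<b) (toWitness a~b)

edges : List (Edge G₁)
edges =
  mkEdge u₁ u₂ ∷ mkEdge u₂ u₃ ∷ mkEdge u₃ u₄ ∷ mkEdge u₁ u₄ ∷
  mkEdge v₁ v₂ ∷ mkEdge v₂ v₃ ∷ mkEdge v₃ v₄ ∷ mkEdge v₄ v₅ ∷ mkEdge v₅ v₆ ∷ mkEdge v₆ v₇ ∷ mkEdge v₁ v₇ ∷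
  mkEdge u₁ v₁ ∷ mkEdge u₂ v₃ ∷ mkEdge u₃ v₄ ∷ mkEdge u₄ v₆ ∷ mkEdge v₂ v₅ ∷ []

edges-unique : Unique edges
edges-unique = from-yes (AllPairs.allPairs? (λ e f → ¬? (e ≟ᵉ f)) edges)

farFrom : Edge G₁ → List (Edge G₁)
farFrom e = filter (λ f → ¬? (closeVia? edges e f)) edges

abstract
  -- Checked by exhaustion; this excludes three edges pairwise at distance at least 3. Equal edges
  -- do no harm, since `CloseVia` includes equality.
  farFrom-close : All (λ e → All (λ f → All (CloseVia edges f) (farFrom e)) (farFrom e)) edges
  farFrom-close = from-yes (All.all? (λ e → All.all? (λ f → All.all? (closeVia? edges f)
    (farFrom e)) (farFrom e)) edges)

  edge-pairs : ∀ a b → a Fin.< b → a ~ b → (a , b) ∈ map (λ e → src e , tgt e) edges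
  edge-pairs = from-yes (Fin.all? λ a → Fin.all? λ b → (a Fin.<? b) →-dec (a ~? b) →-dec
    ((a , b) ∈? map (λ e → src e , tgt e) edges))
    where open DecMembership (Product.≡-dec (Fin._≟_ {11}) (Fin._≟_ {11})) using (_∈?_)

-- The proof fields of an edge are irrelevant, so its pair of ends determines it and `edge-pairs`
-- suffices.
edges-complete : ∀ e → e ∈ edges
edges-complete (edge a b a<b a~b)
  with edge _ _ _ _ , e∈edges , refl ← ∈-map⁻ (λ e → src e , tgt e)
      (edge-pairs a b (recompute (a Fin.<? b) a<b) (recompute (a ~? b) a~b))
  = e∈edges

-- Of three edges, the second and third would both lie in `farFrom` of the first, where any two
-- edges are close.
induced-matching-bound : ∀ {es} → AllPairs (Apart 2) es → length es ℕ.≤ 2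
induced-matching-bound {[]}         _ = z≤n
induced-matching-bound {_ ∷ []}     _ = s≤s z≤n
induced-matching-bound {_ ∷ _ ∷ []} _ = s≤s (s≤s z≤n)
induced-matching-bound {e ∷ f ∷ g ∷ _} ((ef ∷ eg ∷ _) ∷ (fg ∷ _) ∷ _)
  = contradiction fg (close⇒¬apart
      (All.lookup (All.lookup (All.lookup farFrom-close (edges-complete e)) (far ef)) (far eg)))
  where
  far : ∀ {f} → Apart 2 e f → f ∈ farFrom e
  far ef = ∈-filter⁺ (λ f → ¬? (closeVia? edges e f)) (edges-complete _) (λ close → close⇒¬apart close ef)

no-packing : ¬ PackingEdgeColoring G₁ (1 ∷ replicate 5 2)
-- The bounds add up to 15, while `edges` has 16 entries.
no-packing C = ℕ.<-irrefl refl (length≤sum-fibres colour (5 ∷ replicate 5 2) edges bound)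
  where
  open PackingEdgeColoring C

  bound : ∀ c → length (fibre colour c edges) ℕ.≤ Vec.lookup (5 ∷ replicate 5 2) c
  -- Twice the size is at most 11, hence less than `2 * 6`.
  bound zero    = ℕ.s≤s⁻¹ (ℕ.*-cancelˡ-< 2 _ 6 (s≤s (matching-bound (class-apart C zero edges-unique))))
  bound (suc c) = subst (length class ℕ.≤_) (sym (lookup-replicate c 2)) (induced-matching-bound
    (subst (λ s → AllPairs (Apart s) class) (lookup-replicate c 2) (class-apart C (suc c) edges-unique)))
    where class = fibre colour (suc c) edges

-- A straight-line drawing of `G₁`

position : Fin 11 → ℚ²
-- Taking the index of a vertex as first coordinate gives horizontal gaps of at least 1 and no
-- vertical edges. The heights are a witness, verified by the separation checks below.
position v = ℤ.+ toℕ v / 1 , ℤ.+ Vec.lookup heights v / 1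
  where
  heights : Vec ℕ 11
  heights = 7 ∷ 6 ∷ 4 ∷ 0 ∷ 8 ∷ 7 ∷ 3 ∷ 2 ∷ 4 ∷ 1 ∷ 4 ∷ []

abstract
  x-apart : ∀ u v → u ≢ v → 1ℚ ≤ ∣ proj₁ (position v) - proj₁ (position u) ∣
  x-apart = from-yes (Fin.all? λ u → Fin.all? λ v →
    ¬? (u Fin.≟ v) →-dec (1ℚ ≤? ∣ proj₁ (position v) - proj₁ (position u) ∣))

  -- All ordered pairs are checked, because strictness is required only of the first edge.
  edges-separated : All (λ e → All (λ f →
    e ≡ f ⊎ Separated position (src e) (tgt e) (src f) (tgt f)) edges) edges
  edges-separated = from-yes (All.all? (λ e → All.all? (λ f →
    (e ≟ᵉ f) ⊎-dec separated? position (src e) (tgt e) (src f) (tgt f)) edges) edges)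

  -- When `v` is an end of `e`, the normals of `e` and of the degenerate segment fail, and the
  -- vertical line through `v` separates.
  vertices-separated : All (λ e → ∀ v → Separated position (src e) (tgt e) v v) edges
  vertices-separated = from-yes (All.all? (λ e → Fin.all? λ v →
    separated? position (src e) (tgt e) v v) edges)

planar : Planar G₁
planar = straightLineDrawing position x-apart
  (λ e f → All.lookup (All.lookup edges-separated (edges-complete e)) (edges-complete f))
  (λ e → All.lookup vertices-separated (edges-complete e))

-- Maximum degree and girth

subcubic : Subcubic G₁
subcubic = from-yes (maxDegree G₁ ℕ.≤? 3)

triangle-free : ∀ a b c → ¬ (a ~ b × b ~ c × c ~ a)
triangle-free = from-yes (Fin.all? λ a → Fin.all? λ b → Fin.all? λ c →
  ¬? ((a ~? b) ×-dec (b ~? c) ×-dec (c ~? a)))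

girth : HasGirth G₁ 4
girth = (record
  { start    = u₁
  ; others   = u₂ ∷ u₃ ∷ u₄ ∷ []
  ; 3≤length = from-yes (3 ℕ.≤? 4)
  ; distinct = from-yes (AllPairs.allPairs? (λ a b → ¬? (a Fin.≟ b)) (u₁ ∷ u₂ ∷ u₃ ∷ u₄ ∷ []))
  ; closed   = from-yes (linked? _~?_ (u₁ ∷ u₂ ∷ u₃ ∷ u₄ ∷ u₁ ∷ []))
  } , refl) , 4≤length
  where
  4≤length : ∀ C → 4 ℕ.≤ cycleLength C
  4≤length record { others = [] ; 3≤length = s≤s () }
  4≤length record { others = _ ∷ [] ; 3≤length = s≤s (s≤s ()) }
  -- The three links of the closed list form a triangle.
  4≤length record { others = _ ∷ _ ∷ [] ; closed = a~b ∷ b~c ∷ c~a ∷ _ } =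
    contradiction (a~b , b~c , c~a) (triangle-free _ _ _)
  4≤length record { others = _ ∷ _ ∷ _ ∷ _ } = s≤s (s≤s (s≤s (s≤s z≤n)))

mainTheorem5 : Subcubic G₁ × Planar G₁ × HasGirth G₁ 4 × ¬ PackingEdgeColoring G₁ (1 ∷ replicate 5 2)
mainTheorem5 = subcubic , planar , girth , no-packing
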